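{- Let $S$ be a specular set on the finite alphabet $A$ relative to the involution $\theta$, and let $\mathcal{T}_0,\mathcal{T}_1$ be the two trees such that $\mathcal{E}(\varepsilon)=\mathcal{T}_0\cup\mathcal{T}_1$. For any $a,b\in A$ and $i\in\{0,1\}$, the edge $(1\otimes a,b\otimes1)$ is in $\mathcal{T}_i$ if and only if the edge $(1\otimes b^{ -1},a^{ -1}\otimes1)$ is in $\mathcal{T}_{1-i}$.
   Context: Words are over a finite alphabet $A$; $\varepsilon$ is the empty word. A set $S$ of words on $A$ is factorial if it contains $A$ and all the factors of its elements. For $w\in S$ let $L(w)=\{a\in A\mid aw\in S\}$, $R(w)=\{a\in A\mid wa\in S\}$, $B(w)=\{(a,b)\in A\times A\mid awb\in S\}$. A factorial set $S$ is biextendable if $B(w)\neq\emptyset$ for all $w\in S$. The extension graph $\mathcal{E}(w)$ is the undirected graph whose vertex set is the disjoint union of $L(w)$ and $R(w)$, the copy of $a\in L(w)$ being denoted $1\otimes a$ and the copy of $b\in R(w)$ being denoted $b\otimes 1$, with an edge $(1\otimes a,b\otimes1)$ for each $(a,b)\in B(w)$. A biextendable set $S$ is a tree set of characteristic $c$ if $\mathcal{E}(w)$ is a tree for every nonempty $w\in S$ and $\mathcal{E}(\varepsilon)$ is a disjoint union of $c$ trees. Let $\theta$ be an involution on $A$ (possibly with fixed points) and let $G_\theta$ be the group generated by $A$ with relations $a\theta(a)=1$, $a\in A$ (so $a^{ -1}=\theta(a)$). A word is reduced if it has no factor $a\theta(a)$ with $a\in A$; the inverse of a reduced word $a_1\cdots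 a_n$ is the reduced word $\theta(a_n)\cdots\theta(a_1)$. A laminary set on $A$ relative to $\theta$ is a biextendable set of reduced words closed under taking inverses. A specular set is a laminary set which is a tree set of characteristic $2$. -}

module Defs where

open import Data.Empty.Polymorphic using (⊥)
open import Data.Fin.Base using (Fin)
open import Data.List.Base using (List; []; _∷_; _++_; [_]; length; map; reverse)
open import Data.List.Relation.Binary.Infix.Heterogeneous using (Infix; _++ⁱ_; _ⁱ++_)
open import Data.List.Relation.Binary.Infix.Heterogeneous.Properties using (fromPointwise)
open import Data.List.Relation.Binary.Pointwise as Pointwise using ()
open import Data.List.Relation.Unary.Linked using (Linked)
open import Data.List.Relation.Unary.Unique.Propositional using (Unique)
open import Data.Nat.Base using (ℕ; _≤_)
open import Data.Product.Base using (Σ; ∃; _×_; _,_)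
open import Data.Sum.Base using (_⊎_; inj₁; inj₂)
open import Function.Bundles using (_↔_; _⇔_)
open import Level using (Level; _⊔_) renaming (suc to lsuc)
open import Relation.Binary.Construct.Closure.ReflexiveTransitive using (Star)
open import Relation.Binary.Core using (Rel)
open import Relation.Binary.PropositionalEquality using (_≡_; _≢_; refl)
open import Relation.Nullary.Negation using (¬_)
open import Relation.Unary using (Pred; Satisfiable)

Finite : ∀ {a} → Set a → Set a
Finite A = ∃ λ n → A ↔ Fin n

-- Simple undirected graphs whose vertices form a subset V of an ambient type X.
record Graph {x} (X : Set x) (ℓ : Level) : Set (x ⊔ lsuc ℓ) where
  field
    V        : Pred X ℓ
    E        : Rel X ℓ
    E-sym    : ∀ {u v} → E u v → E v u
    E-irrefl : ∀ {u} → ¬ E u u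
    E⇒V      : ∀ {u v} → E u v → V u

module _ {x ℓ : Level} {X : Set x} where

  open Graph

  Connected : Graph X ℓ → Set (x ⊔ ℓ)
  Connected G = ∀ {u v} → V G u → V G v → Star (E G) u v

  -- The cycle u, u₁, …, uₖ, u with pairwise distinct vertices u, u₁, …, uₖ
  -- and k ≥ 2, where us = u₁ … uₖ.
  record Cycle (G : Graph X ℓ) : Set (x ⊔ ℓ) where
    field
      u        : X
      us       : List X
      closed   : Linked (E G) (u ∷ us ++ [ u ])
      distinct : Unique (u ∷ us)
      long     : 2 ≤ length us

  record IsTree (G : Graph X ℓ) : Set (x ⊔ ℓ) where
    field
      nonempty  : Satisfiable (V G)
      connected : Connected G
      acyclic   : ¬ Cycle G

  record IsDisjointUnion {c : ℕ} (G : Graph X ℓ) (T : Fin c → Graph X ℓ) : Set (x ⊔ ℓ) where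
    field
      vertices : ∀ u → V G u ⇔ (∃ λ i → V (T i) u)
      edges    : ∀ u v → E G u v ⇔ (∃ λ i → E (T i) u v)
      disjoint : ∀ {i j u} → V (T i) u → V (T j) u → i ≡ j

module _ {a : Level} {A : Set a} where

  Factor : Rel (List A) a
  Factor = Infix _≡_

  record IsFactorial {ℓ} (S : Pred (List A) ℓ) : Set (a ⊔ ℓ) where
    field
      letters : ∀ x → S [ x ]
      factors : ∀ {u w} → Factor u w → S w → S u

  L : ∀ {ℓ} → Pred (List A) ℓ → List A → Pred A ℓ
  L S w x = S (x ∷ w)

  R : ∀ {ℓ} → Pred (List A) ℓ → List A → Pred A ℓ
  R S w y = S (w ++ [ y ])

  B : ∀ {ℓ} → Pred (List A) ℓ → List A → Pred (A × A) ℓ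
  B S w (x , y) = S (x ∷ w ++ [ y ])

  record IsBiextendable {ℓ} (S : Pred (List A) ℓ) : Set (a ⊔ ℓ) where
    field
      factorial  : IsFactorial S
      extendable : ∀ {w} → S w → Satisfiable (B S w)
    open IsFactorial factorial public

pattern 1⊗_ x = inj₁ x
pattern _⊗1 y = inj₂ y

module _ {a ℓ : Level} {A : Set a} (S : Pred (List A) ℓ) where

  ExtVertex : List A → Pred (A ⊎ A) ℓ
  ExtVertex w (1⊗ x) = L S w x
  ExtVertex w (y ⊗1) = R S w y

  ExtEdge : List A → Rel (A ⊎ A) ℓ
  ExtEdge w (1⊗ x) (y ⊗1) = B S w (x , y)
  ExtEdge w (y ⊗1) (1⊗ x) = B S w (x , y)
  ExtEdge w (1⊗ _) (1⊗ _) = ⊥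
  ExtEdge w (_ ⊗1) (_ ⊗1) = ⊥

  -- Factoriality is what makes the endpoints of an edge vertices.
  𝓔 : IsFactorial S → List A → Graph (A ⊎ A) ℓ
  𝓔 fact w = record
    { V        = ExtVertex w
    ; E        = ExtEdge w
    ; E-sym    = λ {u} {v} → symmetric u v
    ; E-irrefl = λ {u} → irreflexive u
    ; E⇒V      = λ {u} {v} → endpoint u v
    }
    where
    open IsFactorial fact

    factor-refl : ∀ u → Factor u u
    factor-refl u = fromPointwise (Pointwise.refl refl)

    symmetric : ∀ u v → ExtEdge w u v → ExtEdge w v u
    symmetric (1⊗ _) (_ ⊗1) e = e
    symmetric (_ ⊗1) (1⊗ _) e = e

    irreflexive : ∀ u → ¬ ExtEdge w u u
    irreflexive (1⊗ _) ()
    irreflexive (_ ⊗1) ()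

    endpoint : ∀ u v → ExtEdge w u v → ExtVertex w u
    endpoint (1⊗ x) (y ⊗1) = factors (factor-refl (x ∷ w) ⁱ++ [ y ])
    endpoint (y ⊗1) (1⊗ x) = factors ([ x ] ++ⁱ factor-refl (w ++ [ y ]))

  record IsTreeSet (bi : IsBiextendable S) (c : ℕ) : Set (a ⊔ lsuc ℓ) where
    open IsBiextendable bi
    field
      nonempty-word : ∀ {w} → S w → w ≢ [] → IsTree (𝓔 factorial w)
      empty-word    : Σ (Fin c → Graph (A ⊎ A) ℓ) λ T →
                        (∀ i → IsTree (T i)) × IsDisjointUnion (𝓔 factorial []) T

module _ {a : Level} {A : Set a} (θ : A → A) where

  Reduced : Pred (List A) a
  Reduced w = ∀ x → ¬ Factor (x ∷ θ x ∷ []) w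

  inverse : List A → List A
  inverse w = reverse (map θ w)

  record IsLaminary {ℓ} (S : Pred (List A) ℓ) : Set (a ⊔ ℓ) where
    field
      biextendable   : IsBiextendable S
      reduced        : ∀ {w} → S w → Reduced w
      inverse-closed : ∀ {w} → S w → S (inverse w)
    open IsBiextendable biextendable public

  record IsSpecular {ℓ} (S : Pred (List A) ℓ) : Set (a ⊔ lsuc ℓ) where
    field
      laminary : IsLaminary S
    open IsLaminary laminary public
    field
      treeSet : IsTreeSet S biextendable 2
    open IsTreeSet treeSet public

{-# OPTIONS --safe #-}
-- The map φ sending 1⊗a to a⁻¹⊗1 and b⊗1 to 1⊗b⁻¹ is an involutive automorphism
-- of 𝓔(ε), because S is closed under inverses.  It has no fixed vertex, and it
-- flips no edge because the words of S are reduced.  If an edge and its image lay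
-- in the same tree, there would be a walk from some vertex x to φ x.  Take a
-- shortest walk of this form, over all x: following it by its image under φ
-- returns to x, and minimality makes the vertices of this closed walk distinct,
-- so it is a cycle in the forest 𝓔(ε).
module Submission where

open import Defs
open import Data.Empty using (⊥)
open import Data.Fin.Base using (Fin; zero; suc; opposite)
open import Data.Fin.Properties using (opposite-involutive)
open import Data.List.Base using (List; []; _∷_; _++_; [_]; length; map)
open import Data.List.Membership.Propositional using (_∈_)
open import Data.List.Membership.Propositional.Properties using (∈-∃++; ∈-map⁻)
open import Data.List.Properties using (++-assoc; map-++)
open import Data.List.Relation.Binary.Infix.Heterogeneous using (here)
open import Data.List.Relation.Binary.Pointwise as Pointwise using ()
open import Data.List.Relation.Binary.Prefix.Heterogeneous.Properties using (fromPointwise)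
open import Data.List.Relation.Unary.All as All using ()
open import Data.List.Relation.Unary.AllPairs using ([]; _∷_)
open import Data.List.Relation.Unary.Any using (here; there)
open import Data.List.Relation.Unary.Linked as Linked using (Linked; [-]; _∷_)
import Data.List.Relation.Unary.Linked.Properties as Linked
open import Data.List.Relation.Unary.Unique.Propositional using (Unique)
import Data.List.Relation.Unary.Unique.Propositional.Properties as Unique
open import Data.Nat.Base using (ℕ; _<_; z≤n; s≤s)
open import Data.Nat.Induction using (<-wellFounded)
open import Data.Nat.Properties using (≤-refl; ≤-<-trans; <-trans; m<n⇒m<1+n)
open import Data.Product.Base using (∃; _×_; _,_; proj₁; proj₂)
open import Data.Sum.Base using (_⊎_; inj₁; inj₂)
open import Function.Bundles using (_⇔_; mk⇔; Equivalence)
open import Induction.WellFounded using (Acc; acc)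
open import Relation.Binary.Construct.Closure.ReflexiveTransitive as Star using (Star; ε; _◅_)
open import Relation.Binary.Core using (Rel)
open import Relation.Binary.PropositionalEquality using (_≡_; _≢_; refl; sym; trans; cong; subst; subst₂)
open import Relation.Nullary.Negation using (¬_; contradiction)
open import Relation.Unary using (Pred)
open import Algebra.Definitions using (Involutive)

-- Repetitions and order of positions in lists; walks as linked lists.

module _ {a} {A : Set a} where

  length-prefix-< : ∀ (ys : List A) {z zs} → length ys < length (ys ++ z ∷ zs)
  length-prefix-< []       = s≤s z≤n
  length-prefix-< (_ ∷ ys) = s≤s (length-prefix-< ys)

  length-suffix-< : ∀ (ys : List A) {z zs} → length zs < length (ys ++ z ∷ zs)
  length-suffix-< []       = ≤-refl
  length-suffix-< (_ ∷ ys) = m<n⇒m<1+n (length-suffix-< ys)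

  length-++-monoʳ-< : ∀ (xs : List A) {ys zs} → length ys < length zs → length (xs ++ ys) < length (xs ++ zs)
  length-++-monoʳ-< []       p = p
  length-++-monoʳ-< (_ ∷ xs) p = s≤s (length-++-monoʳ-< xs p)

  -- Uniqueness is a negative statement, so no decidable equality on vertices is required. The
  -- factorisation exhibits the loop to be cut out of a walk.
  unique-if-no-repetition : ∀ (us : List A) →
    (∀ xs x ys zs → us ≢ xs ++ x ∷ ys ++ x ∷ zs) → Unique us
  unique-if-no-repetition []       _    = []
  unique-if-no-repetition (u ∷ us) norep =
    All.tabulate (λ v∈us u≡v → fresh (∈-∃++ v∈us) u≡v) ∷
    unique-if-no-repetition us λ xs x ys zs eq → norep (u ∷ xs) x ys zs (cong (u ∷_) eq)
    where
    fresh : ∀ {v} → (∃ λ ys → ∃ λ zs → us ≡ ys ++ v ∷ zs) → u ≢ v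
    fresh (ys , zs , eq) refl = norep [] u ys zs (cong (u ∷_) eq)

  Precedes : List A → Rel A a
  Precedes us x y = ∃ λ xs → ∃ λ ys → ∃ λ zs → us ≡ xs ++ x ∷ ys ++ y ∷ zs

  -- The two membership proofs are compared as positions, so this too avoids deciding equality of
  -- elements.
  ∈-order : ∀ {x y us} → x ∈ us → y ∈ us → x ≡ y ⊎ (Precedes us x y ⊎ Precedes us y x)
  ∈-order (here refl) (here refl) = inj₁ refl
  ∈-order (here refl) (there q) with ∈-∃++ q
  ... | ys , zs , refl = inj₂ (inj₁ ([] , ys , zs , refl))
  ∈-order (there p) (here refl) with ∈-∃++ p
  ... | ys , zs , refl = inj₂ (inj₂ ([] , ys , zs , refl))
  ∈-order {us = u ∷ _} (there p) (there q) with ∈-order p q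
  ... | inj₁ eq                             = inj₁ eq
  ... | inj₂ (inj₁ (xs , ys , zs , refl)) = inj₂ (inj₁ (u ∷ xs , ys , zs , refl))
  ... | inj₂ (inj₂ (xs , ys , zs , refl)) = inj₂ (inj₂ (u ∷ xs , ys , zs , refl))

  module _ {r} {E : Rel A r} where

    linked-suffix : ∀ xs {ys} → Linked E (xs ++ ys) → Linked E ys
    linked-suffix []       l = l
    linked-suffix (_ ∷ xs) l = linked-suffix xs (Linked.tail l)

    linked-prefix : ∀ xs {x ys} → Linked E (xs ++ x ∷ ys) → Linked E (xs ++ [ x ])
    linked-prefix []           l       = [-]
    linked-prefix (_ ∷ [])     (e ∷ _) = e ∷ [-]
    linked-prefix (_ ∷ y ∷ xs) (e ∷ l) = e ∷ linked-prefix (y ∷ xs) l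

    linked-join : ∀ xs {x ys} → Linked E (xs ++ [ x ]) → Linked E (x ∷ ys) → Linked E (xs ++ x ∷ ys)
    linked-join []           _       m = m
    linked-join (_ ∷ [])     (e ∷ _) m = e ∷ m
    linked-join (_ ∷ y ∷ xs) (e ∷ l) m = e ∷ linked-join (y ∷ xs) l m

    star⇒linked : ∀ {x y} → Star E x y → x ≡ y ⊎ (∃ λ us → Linked E (x ∷ us ++ [ y ]))
    star⇒linked ε = inj₁ refl
    star⇒linked (_◅_ {j = z} e p) with star⇒linked p
    ... | inj₁ refl     = inj₂ ([] , e ∷ [-])
    ... | inj₂ (us , l) = inj₂ (z ∷ us , e ∷ l)

-- Involutive automorphisms of acyclic graphs.

module FlipFree {x ℓ} {X : Set x} (G : Graph X ℓ) (φ : X → X)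
  (φ-involutive : Involutive _≡_ φ)
  (φ-hom : ∀ {u v} → Graph.E G u v → Graph.E G (φ u) (φ v))
  (φ-fixpoint-free : ∀ u → u ≢ φ u)
  (φ-flip-free : ∀ u → ¬ Graph.E G u (φ u))
  (acyclic : ¬ Cycle G)
  where

  open Graph G

  φ-injective : ∀ {u v} → φ u ≡ φ v → u ≡ v
  φ-injective {u} {v} eq = trans (sym (φ-involutive u)) (trans (cong φ eq) (φ-involutive v))

  private
    linked-φ : ∀ {u us} → Linked E (u ∷ us ++ [ φ u ]) → Linked E (φ u ∷ map φ us ++ [ u ])
    linked-φ {u} {us} l = subst (λ t → Linked E (φ u ∷ t))
      (trans (map-++ φ us [ φ u ]) (cong (λ t → map φ us ++ [ t ]) (φ-involutive u)))
      (Linked.map⁺ (Linked.map φ-hom l))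

    -- Since `φ (φ u)` is `u`, the image of the walk leads from `φ u` back to `u`, and the two
    -- halves share no vertex. With `us` empty they would traverse one edge back and forth, which is
    -- no cycle; flip-freeness rules this out.
    closed-walk : ∀ u us → Linked E (u ∷ us ++ [ φ u ]) → Unique (u ∷ us) →
      (∀ {w} → w ∈ u ∷ us → ¬ φ w ∈ u ∷ us) → ⊥
    closed-walk u []           (e ∷ _) _    _    = φ-flip-free u e
    closed-walk u us@(v ∷ vs) l uniq disj = acyclic record
      { u        = u
      ; us       = us ++ φ u ∷ map φ us
      ; closed   = subst (λ t → Linked E (u ∷ t)) (sym (++-assoc us (φ u ∷ map φ us) [ u ]))
                     (linked-join (u ∷ us) l (linked-φ {us = us} l))
      ; distinct = Unique.++⁺ uniq (Unique.map⁺ φ-injective uniq) λ (p , q) → disjoint p (∈-map⁻ φ q)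
      ; long     = s≤s (≤-<-trans z≤n (length-prefix-< vs))
      }
      where
      disjoint : ∀ {w} → w ∈ u ∷ us → ¬ (∃ λ y → y ∈ u ∷ us × w ≡ φ y)
      disjoint p (y , q , refl) = disj q p

  -- Well-founded recursion on the number of inner vertices stands in for the choice of a shortest
  -- walk. The start `u` varies, because a shorter walk may begin elsewhere.
  no-walk : ∀ u us → Acc _<_ (length us) → ¬ Linked E (u ∷ us ++ [ φ u ])
  no-walk u us (acc rec) l = closed-walk u us l
    (unique-if-no-repetition (u ∷ us) no-repetition) λ p q → no-image (∈-order p q)
    where
    split : ∀ xs {y} ys {z} zs → u ∷ us ≡ xs ++ y ∷ ys ++ z ∷ zs →
      Linked E (xs ++ y ∷ ys ++ z ∷ zs ++ [ φ u ])
    split xs ys zs eq = subst (Linked E)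
      (trans (cong (_++ [ φ u ]) eq)
        (trans (++-assoc xs _ _) (cong (λ t → xs ++ _ ∷ t) (++-assoc ys _ _)))) l

    gap-< : ∀ xs {y} ys {z} zs → u ∷ us ≡ xs ++ y ∷ ys ++ z ∷ zs → length ys < length us
    gap-< []       ys zs refl = length-prefix-< ys
    gap-< (_ ∷ xs) ys zs refl = <-trans (length-prefix-< ys) (length-suffix-< xs)

    no-repetition : ∀ xs x ys zs → u ∷ us ≢ xs ++ x ∷ ys ++ x ∷ zs
    -- The start `u` recurs: the walk can begin at its second occurrence.
    no-repetition [] x ys zs eq@refl =
      no-walk u zs (rec (length-suffix-< ys)) (linked-suffix (u ∷ ys) (split [] ys zs eq))
    -- An inner vertex recurs: the loop `x ∷ ys` is removed and both ends are kept.
    no-repetition (_ ∷ xs) x ys zs eq@refl =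
      no-walk u (xs ++ x ∷ zs) (rec (length-++-monoʳ-< xs (s≤s (length-suffix-< ys))))
        (subst (λ t → Linked E (u ∷ t)) (sym (++-assoc xs (x ∷ zs) [ φ u ]))
          (linked-join (u ∷ xs) (linked-prefix (u ∷ xs) m) (linked-suffix (u ∷ xs ++ x ∷ ys) m′)))
      where
      m  = split (u ∷ xs) ys zs eq
      m′ = subst (λ t → Linked E (u ∷ t)) (sym (++-assoc xs (x ∷ ys) _)) m

    -- The segment from `y` to `z` is itself a walk from a vertex to its image, with fewer inner
    -- vertices. Taking `z ≡ φ y` as an equation also covers `φ w` preceding `w`, where `w` is the
    -- image of `φ w`.
    no-shorter-walk : ∀ {y z} → z ≡ φ y → ¬ Precedes (u ∷ us) y z
    no-shorter-walk {y} refl (xs , ys , zs , eq) =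
      no-walk y ys (rec (gap-< xs ys zs eq))
        (linked-prefix (y ∷ ys) (linked-suffix xs (split xs ys zs eq)))

    no-image : ∀ {w} → ¬ (w ≡ φ w ⊎ (Precedes (u ∷ us) w (φ w) ⊎ Precedes (u ∷ us) (φ w) w))
    no-image (inj₁ eq)       = φ-fixpoint-free _ eq
    no-image (inj₂ (inj₁ p)) = no-shorter-walk refl p
    no-image (inj₂ (inj₂ p)) = no-shorter-walk (sym (φ-involutive _)) p

  not-connected-to-image : ∀ u → ¬ Star E u (φ u)
  not-connected-to-image u p with star⇒linked p
  ... | inj₁ eq       = φ-fixpoint-free u eq
  ... | inj₂ (us , l) = no-walk u us (<-wellFounded _) l

-- Walks and cycles in a disjoint union of graphs.

module _ {x ℓ} {X : Set x} {c : ℕ} {G : Graph X ℓ} {T : Fin c → Graph X ℓ}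
  (union : IsDisjointUnion G T) where

  open Graph
  open IsDisjointUnion union

  edge-in-component : ∀ {i u v} → V (T i) u → E G u v → E (T i) u v
  edge-in-component {u = u} {v} p e with Equivalence.to (edges u v) e
  ... | j , f = subst (λ k → E (T k) u v) (disjoint (E⇒V (T j) f) p) f

  linked-in-component : ∀ {i u us} → V (T i) u → Linked (E G) (u ∷ us) → Linked (E (T i)) (u ∷ us)
  linked-in-component         p [-]     = [-]
  linked-in-component {i = i} p (e ∷ l) = f ∷ linked-in-component (E⇒V (T i) (E-sym (T i) f)) l
    where f = edge-in-component p e

  -- A walk never leaves the component of its first vertex, so a cycle of the union is a cycle of
  -- one component.
  disjoint-union-acyclic : (∀ i → ¬ Cycle (T i)) → ¬ Cycle G
  disjoint-union-acyclic acyclic C = acyclic i record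
    { u = u ; us = us ; closed = linked-in-component u∈Tᵢ closed ; distinct = distinct ; long = long }
    where
    open Cycle C
    start : ∀ us → Linked (E G) (u ∷ us ++ [ u ]) → V G u
    start []      (e ∷ _) = E⇒V G e
    start (_ ∷ _) (e ∷ _) = E⇒V G e
    component = Equivalence.to (vertices u) (start us closed)
    i     = proj₁ component
    u∈Tᵢ = proj₂ component

-- Inversion acting on the extension graph of the empty word.

module _ {α ℓ} {A : Set α} {θ : A → A} (θ-involutive : Involutive _≡_ θ)
  {S : Pred (List A) ℓ} (specular : IsSpecular θ S) where

  open IsSpecular specular

  reversal : A ⊎ A → A ⊎ A
  reversal (1⊗ x) = θ x ⊗1
  reversal (y ⊗1) = 1⊗ θ y

  reversal-involutive : Involutive _≡_ reversal
  reversal-involutive (1⊗ x) = cong 1⊗_ (θ-involutive x)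
  reversal-involutive (y ⊗1) = cong _⊗1 (θ-involutive y)

  reversal-hom : ∀ {u v} → ExtEdge S [] u v → ExtEdge S [] (reversal u) (reversal v)
  reversal-hom {1⊗ _} {_ ⊗1} = inverse-closed
  reversal-hom {_ ⊗1} {1⊗ _} = inverse-closed

  reversal-fixpoint-free : ∀ u → u ≢ reversal u
  reversal-fixpoint-free (1⊗ _) ()
  reversal-fixpoint-free (_ ⊗1) ()

  reversal-flip-free : ∀ u → ¬ ExtEdge S [] u (reversal u)
  reversal-flip-free (1⊗ x) e = reduced e x (here (fromPointwise (Pointwise.refl refl)))
  -- The edge is the word `θ y`, `y`, which has the forbidden form once `y` is rewritten as
  -- `θ (θ y)`.
  reversal-flip-free (y ⊗1) e = reduced e (θ y)
    (here (fromPointwise (refl Pointwise.∷ θ-involutive y Pointwise.∷ Pointwise.[])))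

  module _ {𝓣 : Fin 2 → Graph (A ⊎ A) ℓ} (trees : ∀ i → IsTree (𝓣 i))
    (union : IsDisjointUnion (𝓔 S factorial []) 𝓣) where

    open Graph
    open IsDisjointUnion union

    reversal-leaves-component : ∀ {i} u → V (𝓣 i) u → ¬ V (𝓣 i) (reversal u)
    reversal-leaves-component {i} u p q = not-connected-to-image u
      (Star.map (λ {v} {w} e → Equivalence.from (edges v w) (i , e)) (IsTree.connected (trees i) p q))
      where
      open FlipFree (𝓔 S factorial []) reversal reversal-involutive
        (λ {u} {v} → reversal-hom {u} {v}) reversal-fixpoint-free reversal-flip-free
        (disjoint-union-acyclic union (λ i → IsTree.acyclic (trees i)))

    opposite-if-distinct : ∀ (i j : Fin 2) → i ≢ j → j ≡ opposite i
    opposite-if-distinct zero       zero       i≢j = contradiction refl i≢j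
    opposite-if-distinct zero       (suc zero) _   = refl
    opposite-if-distinct (suc zero) zero       _   = refl
    opposite-if-distinct (suc zero) (suc zero) i≢j = contradiction refl i≢j

    -- Closure under inverses puts the reversed edge in some tree `𝓣 j`. If `j` were `i`, that tree
    -- would contain both `1⊗ a` and its image `θ a ⊗1`; with two trees, only `opposite i` remains.
    reversed-edge : ∀ {i a b} → E (𝓣 i) (1⊗ a) (b ⊗1) → E (𝓣 (opposite i)) (1⊗ θ b) (θ a ⊗1)
    reversed-edge {i} {a} {b} e
      with j , f ← Equivalence.to (edges (1⊗ θ b) (θ a ⊗1))
                     (inverse-closed (Equivalence.from (edges (1⊗ a) (b ⊗1)) (i , e)))
      = subst (λ k → E (𝓣 k) (1⊗ θ b) (θ a ⊗1)) (opposite-if-distinct i j i≢j) f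
      where
      i≢j : i ≢ j
      i≢j refl = reversal-leaves-component (1⊗ a) (E⇒V (𝓣 i) e) (E⇒V (𝓣 i) (E-sym (𝓣 i) f))

proposition4p3 : ∀ {α ℓ} {A : Set α} → Finite A →
    (θ : A → A) → Involutive _≡_ θ →
    (S : Pred (List A) ℓ) (specular : IsSpecular θ S) →
    (𝓣 : Fin 2 → Graph (A ⊎ A) ℓ) → (∀ i → IsTree (𝓣 i)) →
    IsDisjointUnion (𝓔 S (IsSpecular.factorial specular) []) 𝓣 →
    ∀ (a b : A) (i : Fin 2) →
    Graph.E (𝓣 i) (1⊗ a) (b ⊗1) ⇔ Graph.E (𝓣 (opposite i)) (1⊗ (θ b)) ((θ a) ⊗1)
proposition4p3 _ θ θ-involutive S specular 𝓣 trees union a b i = mk⇔ rev back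
  where
  rev : ∀ {i a b} → Graph.E (𝓣 i) (1⊗ a) (b ⊗1) → Graph.E (𝓣 (opposite i)) (1⊗ (θ b)) ((θ a) ⊗1)
  rev = reversed-edge θ-involutive specular trees union

  -- The converse is `rev` applied to the reversed edge, since `opposite` and `θ` are both
  -- involutions.
  back : Graph.E (𝓣 (opposite i)) (1⊗ (θ b)) ((θ a) ⊗1) → Graph.E (𝓣 i) (1⊗ a) (b ⊗1)
  back e = subst₂ (λ x y → Graph.E (𝓣 i) (1⊗ x) (y ⊗1)) (θ-involutive a) (θ-involutive b)
    (subst (λ k → Graph.E (𝓣 k) (1⊗ (θ (θ a))) ((θ (θ b)) ⊗1)) (opposite-involutive i) (rev e))
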